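{- Let $\mathcal{A}\subseteq 2^{[n]}$ be an arbitrary family of sets. For $A\in\mathcal{A}$ let $c(A)$ be the maximum $k$ such that $A$ belongs to a $k$-chain consisting of sets from $\mathcal{A}$. Then \[ \sum_{A\in\mathcal{A}} \frac{1}{\binom{n}{|A|}\,c(A)} \le 1, \] and equality holds if and only if $\mathcal{A}$ is a nonempty union of complete levels, i.e. $\mathcal{A}=\bigcup_{i\in I}\binom{[n]}{i}$ for some nonempty $I\subseteq\{0,1,\dots,n\}$.
   Context: $[n]=\{1,\dots,n\}$ and $2^{[n]}$ is its power set. A $k$-chain is a collection of $k$ sets $A_1\subsetneq A_2\subsetneq\cdots\subsetneq A_k$. $\binom{[n]}{i}$ denotes the family of all $i$-element subsets of $[n]$ (the $i$-th level). -}

module Defs where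

open import Data.Bool.Properties using () renaming (_≟_ to _≟ᵇ_)
open import Data.Fin.Base using (Fin; toℕ)
open import Data.Fin.Subset using (Subset; inside; outside; ∣_∣; _⊂_) renaming (_∈_ to _∈ˢ_)
open import Data.Fin.Subset.Properties using (_⊂?_; anySubset?; p⊂q⇒∣p∣<∣q∣; ∣p∣≤n)
open import Data.Integer.Base using (1ℤ)
open import Data.Nat.Base as ℕ using (ℕ; zero; suc; _≤_; s≤s; s≤s⁻¹; NonZero)
open import Data.Nat.Combinatorics using (_C_; nCk+nC[k+1]≡[n+1]C[k+1])
open import Data.Nat.Properties
  using (≤-refl; ≤-trans; m≤m+n; m≤n+m; +-suc; +-identityʳ; +-monoˡ-≤; m≤n⇒m<n∨m≡n; m*n≢0)
open import Data.Product.Base using (∃; ∃-syntax; Σ-syntax; _×_; _,_; proj₁; proj₂)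
open import Data.Rational.Base as ℚ using (ℚ; 0ℚ; _/_)
open import Data.Sum.Base using (inj₁; inj₂)
open import Data.Vec.Base using (Vec; []; _∷_)
open import Data.Vec.Properties using (≡-dec)
open import Data.Vec.Membership.Propositional using (_∈_)
open import Data.Vec.Relation.Unary.All as All using (All; []; _∷_)
open import Data.Vec.Relation.Unary.Any using (here)
open import Data.Vec.Relation.Unary.Linked using (Linked; []; [-]; _∷_; linked?)
open import Function.Base using (_∘_)
open import Level using (Level; 0ℓ)
open import Relation.Binary.PropositionalEquality using (_≡_; refl; sym; subst)
open import Relation.Nullary using (Dec; yes; no; contradiction)
open import Relation.Nullary.Decidable using (_×-dec_; map′)
open import Relation.Unary using (Pred; Decidable)

private
  variable
    ℓ : Level
    n k : ℕ

-- A family of subsets of [n] is a predicate on Subset n.  Families are taken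
-- to be decidable, as every family of finite sets is classically; this is what
-- makes the maximum c(A) and the sum over the family computable.

-- A₁ ⊊ ⋯ ⊊ Aₖ, all in 𝒜, one of the Aᵢ being A.
InChain : Pred (Subset n) ℓ → Subset n → ℕ → Set ℓ
InChain {n} 𝒜 A k = Σ[ As ∈ Vec (Subset n) k ] Linked _⊂_ As × All 𝒜 As × A ∈ As

anySubsetVec? : {P : Pred (Vec (Subset n) k) ℓ} → Decidable P → Dec (∃ P)
anySubsetVec? {k = zero}  P? = map′ ([] ,_) (λ { ([] , p) → p }) (P? [])
anySubsetVec? {k = suc _} P? =
  map′ (λ (A , As , p) → (A ∷ As) , p) (λ { (A ∷ As , p) → A , As , p })
       (anySubset? λ A → anySubsetVec? λ As → P? (A ∷ As))

inChain? : {𝒜 : Pred (Subset n) ℓ} → Decidable 𝒜 → ∀ A → Decidable (InChain 𝒜 A)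
inChain? 𝒜? A k =
  anySubsetVec? λ As → linked? _⊂?_ As ×-dec All.all? 𝒜? As ×-dec A ∈? As
  where open import Data.Vec.Membership.DecPropositional (≡-dec _≟ᵇ_) using (_∈?_)

IsMaximum : Pred ℕ ℓ → ℕ → Set ℓ
IsMaximum P m = P m × (∀ {k} → P k → k ≤ m)

-- The largest k ≤ b satisfying P, or 0 if there is none.
greatest : {P : Pred ℕ ℓ} → Decidable P → ℕ → ℕ
greatest P? zero = zero
greatest P? (suc b) with P? (suc b)
... | yes _ = suc b
... | no  _ = greatest P? b

-- Chains in 2^[n] have at most n + 1 members, so the search bound is harmless:
-- see c-isMaximum.
c : {𝒜 : Pred (Subset n) ℓ} → Decidable 𝒜 → Subset n → ℕ
c {n} 𝒜? A = greatest (inChain? 𝒜? A) (suc n)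

greatest-isMaximum : {P : Pred ℕ ℓ} (P? : Decidable P) (b : ℕ) →
  ∃ P → (∀ {k} → P k → k ≤ b) → IsMaximum P (greatest P? b)
greatest-isMaximum P? zero (k , pk) bound with bound pk
... | ℕ.z≤n = pk , bound
greatest-isMaximum {P = P} P? (suc b) ∃P bound with P? (suc b)
... | yes p  = p , bound
... | no  ¬p = greatest-isMaximum P? b ∃P bound′
  where
  bound′ : ∀ {k} → P k → k ≤ b
  bound′ pk with m≤n⇒m<n∨m≡n (bound pk)
  ... | inj₁ k<1+b = s≤s⁻¹ k<1+b
  ... | inj₂ refl  = contradiction pk ¬p

chain-length : {A : Subset n} {As : Vec (Subset n) k} →
  Linked _⊂_ (A ∷ As) → ∣ A ∣ ℕ.+ k ≤ n
chain-length {n} {A = A} [-] = subst (_≤ n) (sym (+-identityʳ ∣ A ∣)) (∣p∣≤n A)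
chain-length {n} {k = suc k} {A = A} {As = B ∷ _} (A⊂B ∷ ch) =
  subst (_≤ n) (sym (+-suc ∣ A ∣ k))
    (≤-trans (+-monoˡ-≤ k (p⊂q⇒∣p∣<∣q∣ A⊂B)) (chain-length ch))

inChain⇒≤ : {𝒜 : Pred (Subset n) ℓ} {A : Subset n} → InChain 𝒜 A k → k ≤ suc n
inChain⇒≤ ([]     , _)        = ℕ.z≤n
inChain⇒≤ (A ∷ As , ch , _) = s≤s (≤-trans (m≤n+m _ ∣ A ∣) (chain-length ch))

inChain-one : {𝒜 : Pred (Subset n) ℓ} {A : Subset n} → 𝒜 A → InChain 𝒜 A 1
inChain-one {A = A} A∈𝒜 = (A ∷ []) , [-] , (A∈𝒜 ∷ []) , here refl

c-isMaximum : {𝒜 : Pred (Subset n) ℓ} (𝒜? : Decidable 𝒜) {A : Subset n} →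
  𝒜 A → IsMaximum (InChain 𝒜 A) (c 𝒜? A)
c-isMaximum {n} 𝒜? {A} A∈𝒜 =
  greatest-isMaximum (inChain? 𝒜? A) (suc n) (1 , inChain-one A∈𝒜) inChain⇒≤

c≢0 : {𝒜 : Pred (Subset n) ℓ} (𝒜? : Decidable 𝒜) {A : Subset n} →
  𝒜 A → NonZero (c 𝒜? A)
c≢0 𝒜? A∈𝒜 = ℕ.>-nonZero (proj₂ (c-isMaximum 𝒜? A∈𝒜) (inChain-one A∈𝒜))

1≤nCk : ∀ {n k} → k ≤ n → 1 ≤ n C k
1≤nCk {n}     {zero}  _         = ≤-refl
1≤nCk {suc n} {suc k} (s≤s k≤n) =
  subst (1 ≤_) (nCk+nC[k+1]≡[n+1]C[k+1] n k) (≤-trans (1≤nCk k≤n) (m≤m+n _ _))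

nC∣A∣≢0 : (A : Subset n) → NonZero (n C ∣ A ∣)
nC∣A∣≢0 A = ℕ.>-nonZero (1≤nCk (∣p∣≤n A))

weight : {𝒜 : Pred (Subset n) ℓ} → Decidable 𝒜 → (A : Subset n) → 𝒜 A → ℚ
weight {n} 𝒜? A A∈𝒜 = (1ℤ / ((n C ∣ A ∣) ℕ.* c 𝒜? A)) {{nz}}
  where nz = m*n≢0 _ _ {{nC∣A∣≢0 A}} {{c≢0 𝒜? A∈𝒜}}

∑Subset : (Subset n → ℚ) → ℚ
∑Subset {zero}  f = f []
∑Subset {suc n} f = ∑Subset (f ∘ (outside ∷_)) ℚ.+ ∑Subset (f ∘ (inside ∷_))

-- The sum of f over the members of 𝒜 only.
∑ : {𝒜 : Pred (Subset n) ℓ} → Decidable 𝒜 → ((A : Subset n) → 𝒜 A → ℚ) → ℚ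
∑ {n} {𝒜 = 𝒜} 𝒜? f = ∑Subset λ A → restrict (𝒜? A)
  where
  restrict : {A : Subset n} → Dec (𝒜 A) → ℚ
  restrict {A} (yes A∈𝒜) = f A A∈𝒜
  restrict     (no  _)   = 0ℚ

level : ℕ → Pred (Subset n) 0ℓ
level i A = ∣ A ∣ ≡ i

-- I ⊆ {0, …, n} is a Subset (suc n), with i : Fin (suc n) standing for toℕ i.
unionOfLevels : Subset (suc n) → Pred (Subset n) 0ℓ
unionOfLevels I A = ∃[ i ] (i ∈ˢ I × level (toℕ i) A)

{-# OPTIONS --safe #-}
module Submission where

-- For a maximal chain ("flag") F, every A in F ∩ 𝒜 has c(A) ≥ |F ∩ 𝒜|, so the sum of
-- 1 / c(A) over F ∩ 𝒜 is at most 1.  A set A lies on ∣A∣! (n − ∣A∣)! of the n! flags, so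
-- averaging over all flags gives the inequality.  In case of equality all flags have the same
-- sum 1; as two flags that differ in one set give the two sets the same share, the share
-- (1 / c on 𝒜, and 0 elsewhere) is constant on levels, and its support 𝒜 is a union of
-- levels.  Conversely, for a nonempty union of levels c(A) = |F ∩ 𝒜| for all A in 𝒜.

open import Defs
open import Algebra.Bundles using (CommutativeMonoid)
import Algebra.Properties.CommutativeSemigroup as CommutativeSemigroup
open import Data.Bool.Base using (true)
open import Data.Fin.Base using (Fin; zero; suc; toℕ; fromℕ; fromℕ<; inject₁)
open import Data.Fin.Properties using (toℕ-fromℕ; toℕ-fromℕ<; toℕ-inject₁)
open import Data.Fin.Subset
  using (Subset; Nonempty; inside; outside; ∣_∣; ∁; _⊂_; ⊤; ⊥) renaming (_∈_ to _∈ˢ_)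
open import Data.Fin.Subset.Properties
  using (∣p∣≤n; ∣p∣≡n⇒p≡⊤; ∣∁p∣≡n∸∣p∣; p⊂q⇒∣p∣<∣q∣; ⊂-trans; s⊂s; out⊂in; ⊆-refl)
open import Data.Integer.Base as ℤ using (1ℤ)
import Data.Integer.Properties as ℤ
open import Data.Nat.Base as ℕ using (ℕ; zero; suc; NonZero; _!)
open import Data.Nat.Combinatorics using (_C_; nCk≡n!/k![n-k]!; k![n∸k]!∣n!)
open import Data.Nat.DivMod using (m*[n/m]≡n)
import Data.Nat.Properties as ℕ
open import Data.Product.Base using (∃; _×_; Σ-syntax; _,_; proj₁; proj₂)
open import Data.Rational.Base using (ℚ; 0ℚ; 1ℚ; _/_; _+_; _≤_; _<_; fromℚᵘ; toℚᵘ)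
open import Data.Rational.Properties
import Data.Rational.Unnormalised.Base as ℚᵘ
import Data.Rational.Unnormalised.Properties as ℚᵘ
open import Data.Sum.Base using (inj₁; inj₂)
open import Data.Vec.Base using (Vec; []; _∷_; lookup; map; count; tabulate)
open import Data.Vec.Membership.Propositional using (_∈_)
import Data.Vec.Properties as Vec
open import Data.Vec.Relation.Unary.All as All using (All; []; _∷_)
open import Data.Vec.Relation.Unary.Any using (here; there)
open import Data.Vec.Relation.Unary.Linked as Linked using (Linked; []; [-]; _∷_)
import Data.Vec.Relation.Unary.Linked.Properties as Linked
open import Function.Base using (_∘_)
open import Function.Bundles using (_⇔_; mk⇔)
open import Relation.Binary.PropositionalEquality
open import Relation.Nullary using (Dec; does; yes; no; contradiction)
open import Relation.Nullary.Decidable using (dec-true; toWitness)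
open import Relation.Unary using (Pred; Decidable; _≐_)

open import Algebra.Properties.CommutativeMonoid.Mult +-0-commutativeMonoid
  using (×-homo-1; ×-assocˡ; ×-distrib-+) renaming (_×_ to _·_)
open import Algebra.Properties.CommutativeMonoid.Sum +-0-commutativeMonoid
  using (sum; sum-cong-≗; sum-replicate; ∑-distrib-+)
open import Algebra.Properties.Group +-0-group
  using () renaming (∙-cancelˡ to +-cancelˡ; ∙-cancelʳ to +-cancelʳ)
open CommutativeSemigroup (CommutativeMonoid.commutativeSemigroup +-0-commutativeMonoid)
  using () renaming (interchange to +-interchange)
open import Algebra.Solver.CommutativeMonoid +-0-commutativeMonoid using (solve; _⊕_; _⊜_)

private
  variable
    m n k : ℕ

-- Unit fractions, natural multiples and cancellation in the rationals.

/-≡ : ∀ a b c d .{{_ : NonZero c}} .{{_ : NonZero d}} →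
  a ℕ.* d ≡ b ℕ.* c → ℤ.+ a / c ≡ ℤ.+ b / d
/-≡ a b (suc c) (suc d) eq = fromℚᵘ-cong {ℚᵘ.mkℚᵘ (ℤ.+ a) c} {ℚᵘ.mkℚᵘ (ℤ.+ b) d}
  (ℚᵘ.*≡* (trans (sym (ℤ.pos-* a (suc d))) (trans (cong ℤ.+_ eq) (ℤ.pos-* b (suc c)))))

1/-antimono-≤ : ∀ a b .{{_ : NonZero a}} .{{_ : NonZero b}} → a ℕ.≤ b → 1ℤ / b ≤ 1ℤ / a
1/-antimono-≤ (suc a) (suc b) a≤b = toℚᵘ-cancel-≤ (begin
  toℚᵘ (1ℤ / suc b)  ≃⟨ toℚᵘ-fromℚᵘ (ℚᵘ.mkℚᵘ 1ℤ b) ⟩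
  ℚᵘ.mkℚᵘ 1ℤ b       ≤⟨ ℚᵘ.*≤* (ℤ.*-monoˡ-≤-nonNeg 1ℤ (ℤ.+≤+ a≤b)) ⟩
  ℚᵘ.mkℚᵘ 1ℤ a       ≃⟨ toℚᵘ-fromℚᵘ (ℚᵘ.mkℚᵘ 1ℤ a) ⟨
  toℚᵘ (1ℤ / suc a)  ∎)
  where open ℚᵘ.≤-Reasoning

1/-positive : ∀ a .{{_ : NonZero a}} → 0ℚ < 1ℤ / a
1/-positive a = positive⁻¹ (1ℤ / a) {{normalize-pos 1 a}}

/-distribʳ-+ : ∀ a b c .{{_ : NonZero c}} → ℤ.+ a / c + ℤ.+ b / c ≡ ℤ.+ (a ℕ.+ b) / c
/-distribʳ-+ a b (suc c) = toℚᵘ-injective (begin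
  toℚᵘ (fromℚᵘ p + fromℚᵘ q)           ≈⟨ toℚᵘ-homo-+ (fromℚᵘ p) (fromℚᵘ q) ⟩
  toℚᵘ (fromℚᵘ p) ℚᵘ.+ toℚᵘ (fromℚᵘ q) ≈⟨ ℚᵘ.+-cong (toℚᵘ-fromℚᵘ p) (toℚᵘ-fromℚᵘ q) ⟩
  p ℚᵘ.+ q                             ≈⟨ ℚᵘ.*≡* num ⟩
  ℚᵘ.mkℚᵘ (ℤ.+ (a ℕ.+ b)) c            ≈⟨ toℚᵘ-fromℚᵘ (ℚᵘ.mkℚᵘ (ℤ.+ (a ℕ.+ b)) c) ⟨
  toℚᵘ (ℤ.+ (a ℕ.+ b) / suc c)         ∎)
  where
  open import Relation.Binary.Reasoning.Setoid ℚᵘ.≃-setoid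
  p = ℚᵘ.mkℚᵘ (ℤ.+ a) c
  q = ℚᵘ.mkℚᵘ (ℤ.+ b) c
  num : (ℤ.+ a ℤ.* ℤ.+ suc c ℤ.+ ℤ.+ b ℤ.* ℤ.+ suc c) ℤ.* ℤ.+ suc c ≡
    ℤ.+ (a ℕ.+ b) ℤ.* (ℤ.+ suc c ℤ.* ℤ.+ suc c)
  num = trans (cong (ℤ._* ℤ.+ suc c) (sym (ℤ.*-distribʳ-+ (ℤ.+ suc c) (ℤ.+ a) (ℤ.+ b))))
              (ℤ.*-assoc (ℤ.+ (a ℕ.+ b)) (ℤ.+ suc c) (ℤ.+ suc c))

·-1/ : ∀ m k .{{_ : NonZero k}} → m · (1ℤ / k) ≡ ℤ.+ m / k
·-1/ zero    k = /-≡ 0 0 1 k refl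
·-1/ (suc m) k = trans (cong (λ q → 1ℤ / k + q) (·-1/ m k)) (/-distribʳ-+ 1 m k)

·-1/-self : ∀ m .{{_ : NonZero m}} → m · (1ℤ / m) ≡ 1ℚ
·-1/-self m = trans (·-1/ m m) (/-≡ m 1 m 1 (ℕ.*-comm m 1))

·-1/-cancel : ∀ m k .{{_ : NonZero k}} .{{_ : NonZero (m ℕ.* k)}} →
  m · (1ℤ / (m ℕ.* k)) ≡ 1ℤ / k
·-1/-cancel m k = trans (·-1/ m (m ℕ.* k)) (/-≡ m 1 (m ℕ.* k) k (sym (ℕ.*-identityˡ _)))

·-zero : ∀ m → m · 0ℚ ≡ 0ℚ
·-zero zero    = refl
·-zero (suc m) = trans (+-identityˡ _) (·-zero m)

·-mono-≤ : ∀ m {p q} → p ≤ q → m · p ≤ m · q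
·-mono-≤ zero    p≤q = ≤-refl
·-mono-≤ (suc m) p≤q = +-mono-≤ p≤q (·-mono-≤ m p≤q)

·-cancel-≤ : ∀ m .{{_ : NonZero m}} {p q} → m · p ≤ m · q → p ≤ q
·-cancel-≤ (suc m) mp≤mq = ≮⇒≥ λ q<p →
  <-irrefl refl (<-≤-trans (+-mono-<-≤ q<p (·-mono-≤ m (<⇒≤ q<p))) mp≤mq)

+-cancelˡ-≤ : ∀ {p q} r → r + p ≤ r + q → p ≤ q
+-cancelˡ-≤ r rp≤rq = ≮⇒≥ λ q<p → <-irrefl refl (<-≤-trans (+-monoʳ-< r q<p) rp≤rq)

+-cancelʳ-≤ : ∀ {p q} r → p + r ≤ q + r → p ≤ q
+-cancelʳ-≤ r pr≤qr = ≮⇒≥ λ q<p → <-irrefl refl (<-≤-trans (+-monoˡ-< r q<p) pr≤qr)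

-- Sums over a family and along a list of sets.

restrict : ∀ {ℓ} {P : Set ℓ} → Dec P → (P → ℚ) → ℚ
restrict (yes p) f = f p
restrict (no  _) f = 0ℚ

restrict-positive : ∀ {ℓ} {P : Set ℓ} (P? : Dec P) {f : P → ℚ} →
  P → (∀ p → 0ℚ < f p) → 0ℚ < restrict P? f
restrict-positive (yes p) _ 0<f = 0<f p
restrict-positive (no ¬p) p _   = contradiction p ¬p

restrict-positive⁻¹ : ∀ {ℓ} {P : Set ℓ} (P? : Dec P) {f : P → ℚ} → 0ℚ < restrict P? f → P
restrict-positive⁻¹ (yes p) _   = p
restrict-positive⁻¹ (no _)  0<0 = contradiction 0<0 (<-irrefl refl)

restrict-·-cong : ∀ {ℓ} {P : Set ℓ} (P? : Dec P) j k {f g : P → ℚ} →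
  (∀ p → j · f p ≡ k · g p) → j · restrict P? f ≡ k · restrict P? g
restrict-·-cong (yes p) j k f≗g = f≗g p
restrict-·-cong (no _)  j k _   = trans (·-zero j) (sym (·-zero k))

∑Subset-cong : {f g : Subset n → ℚ} → (∀ A → f A ≡ g A) → ∑Subset f ≡ ∑Subset g
∑Subset-cong {zero}  f≗g = f≗g []
∑Subset-cong {suc n} f≗g =
  cong₂ _+_ (∑Subset-cong (f≗g ∘ (outside ∷_))) (∑Subset-cong (f≗g ∘ (inside ∷_)))

∑Subset-+ : (f g : Subset n → ℚ) → ∑Subset (λ A → f A + g A) ≡ ∑Subset f + ∑Subset g
∑Subset-+ {zero}  f g = refl
∑Subset-+ {suc n} f g = trans
  (cong₂ _+_ (∑Subset-+ (f ∘ (outside ∷_)) (g ∘ (outside ∷_)))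
             (∑Subset-+ (f ∘ (inside ∷_)) (g ∘ (inside ∷_))))
  (+-interchange (∑Subset (f ∘ (outside ∷_))) _ _ _)

∑Subset-· : ∀ m (f : Subset n → ℚ) → m · ∑Subset f ≡ ∑Subset (λ A → m · f A)
∑Subset-· {zero}  m f = refl
∑Subset-· {suc n} m f = trans (×-distrib-+ (∑Subset (f ∘ (outside ∷_))) _ m)
  (cong₂ _+_ (∑Subset-· m (f ∘ (outside ∷_))) (∑Subset-· m (f ∘ (inside ∷_))))

module _ {ℓ} {𝒜 : Pred (Subset n) ℓ} (𝒜? : Decidable 𝒜) (f : (A : Subset n) → 𝒜 A → ℚ) where

  -- The summand of ∑ has no name outside Defs; unification recovers it here.
  private
    ∑-unfold : Σ[ g ∈ (Subset n → ℚ) ] ∑ 𝒜? f ≡ ∑Subset g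
    ∑-unfold = _ , refl

    ∑-summand : ∀ A → proj₁ ∑-unfold A ≡ restrict (𝒜? A) (f A)
    ∑-summand A with 𝒜? A
    ... | yes _ = refl
    ... | no  _ = refl

  ∑≡∑Subset : ∑ 𝒜? f ≡ ∑Subset (λ A → restrict (𝒜? A) (f A))
  ∑≡∑Subset = trans (proj₂ ∑-unfold) (∑Subset-cong ∑-summand)

total : (Subset n → ℚ) → Vec (Subset n) m → ℚ
total f []       = 0ℚ
total f (A ∷ As) = f A + total f As

module _ {ℓ} {𝒜 : Pred (Subset n) ℓ} (𝒜? : Decidable 𝒜) (f : (A : Subset n) → 𝒜 A → ℚ) where

  total-restrict-≤ : ∀ {q} (As : Vec (Subset n) m) →
    (∀ {A} → A ∈ As → (A∈𝒜 : 𝒜 A) → f A A∈𝒜 ≤ q) →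
    total (λ A → restrict (𝒜? A) (f A)) As ≤ count 𝒜? As · q
  total-restrict-≤ []       f≤q = ≤-refl
  total-restrict-≤ (A ∷ As) f≤q with 𝒜? A
  ... | yes A∈𝒜 = +-mono-≤ (f≤q (here refl) A∈𝒜) (total-restrict-≤ As (f≤q ∘ there))
  ... | no  _   = ≤-trans (≤-reflexive (+-identityˡ _)) (total-restrict-≤ As (f≤q ∘ there))

  total-restrict-≡ : ∀ {q} (As : Vec (Subset n) m) →
    (∀ {A} → A ∈ As → (A∈𝒜 : 𝒜 A) → f A A∈𝒜 ≡ q) →
    total (λ A → restrict (𝒜? A) (f A)) As ≡ count 𝒜? As · q
  total-restrict-≡ []       f≡q = refl
  total-restrict-≡ (A ∷ As) f≡q with 𝒜? A
  ... | yes A∈𝒜 = cong₂ _+_ (f≡q (here refl) A∈𝒜) (total-restrict-≡ As (f≡q ∘ there))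
  ... | no  _   = trans (+-identityˡ _) (total-restrict-≡ As (f≡q ∘ there))

  -- Without a member of `𝒜` the total would be 0; the empty vector is excluded for the same reason.
  -- This later yields a nonempty index set.
  total-restrict-≡1⇒∃ : (As : Vec (Subset n) m) → total (λ A → restrict (𝒜? A) (f A)) As ≡ 1ℚ →
    ∃ λ i → 𝒜 (lookup As i)
  total-restrict-≡1⇒∃ (A ∷ As) ≡1 with 𝒜? A
  ... | yes A∈𝒜 = zero , A∈𝒜
  ... | no  _   =
    let i , Aᵢ∈𝒜 = total-restrict-≡1⇒∃ As (trans (sym (+-identityˡ _)) ≡1) in suc i , Aᵢ∈𝒜

-- Flags: the maximal chains of the cube, built one element at a time.

-- F ▷ i inserts a new first element into the flag F = (A₀ ⊂ ⋯ ⊂ Aₙ) after Aᵢ; the result is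
-- A₀ ⊂ ⋯ ⊂ Aᵢ ⊂ {new} ∪ Aᵢ ⊂ ⋯ ⊂ {new} ∪ Aₙ.
data Flag : ℕ → Set where
  []  : Flag 0
  _▷_ : Flag n → Fin (suc n) → Flag (suc n)

splice : Fin (suc m) → Vec (Subset n) (suc m) → Vec (Subset (suc n)) (suc (suc m))
splice             zero    (A ∷ As)     = (outside ∷ A) ∷ (inside ∷ A) ∷ map (inside ∷_) As
splice {m = suc _} (suc i) (A ∷ B ∷ As) = (outside ∷ A) ∷ splice i (B ∷ As)

sets : Flag n → Vec (Subset n) (suc n)
sets []      = [] ∷ []
sets (F ▷ i) = splice i (sets F)

-- The offset `d` makes the notion pass to tails; a whole flag has `d = 0`.
Ranked : ℕ → Vec (Subset n) m → Set
Ranked d As = ∀ i → ∣ lookup As i ∣ ≡ d ℕ.+ toℕ i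

ranked-tail : ∀ {d} {A : Subset n} {As : Vec (Subset n) m} → Ranked d (A ∷ As) → Ranked (suc d) As
ranked-tail {d = d} rk i = trans (rk (suc i)) (ℕ.+-suc d (toℕ i))

ranked-∷ : ∀ {d} {A : Subset n} {As : Vec (Subset n) m} →
  ∣ A ∣ ≡ d → Ranked (suc d) As → Ranked d (A ∷ As)
ranked-∷ {d = d} ∣A∣≡d rk zero    = trans ∣A∣≡d (sym (ℕ.+-identityʳ d))
ranked-∷ {d = d} ∣A∣≡d rk (suc i) = trans (rk i) (sym (ℕ.+-suc d (toℕ i)))

ranked-head : ∀ {d} {A : Subset n} {As : Vec (Subset n) m} → Ranked d (A ∷ As) → ∣ A ∣ ≡ d
ranked-head {d = d} rk = trans (rk zero) (ℕ.+-identityʳ d)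

ranked-map : ∀ {d} (As : Vec (Subset n) m) → Ranked d As → Ranked (suc d) (map (inside ∷_) As)
ranked-map []       rk ()
ranked-map (A ∷ As) rk = ranked-∷ {As = map (inside ∷_) As} (cong suc (ranked-head {As = As} rk))
  (ranked-map As (ranked-tail {A = A} {As} rk))

ranked-splice : ∀ {d} (i : Fin (suc m)) (As : Vec (Subset n) (suc m)) →
  Ranked d As → Ranked d (splice i As)
ranked-splice             zero    (A ∷ As)     rk =
  ranked-∷ {As = map (inside ∷_) (A ∷ As)} (ranked-head {As = As} rk) (ranked-map (A ∷ As) rk)
ranked-splice {m = suc _} (suc i) (A ∷ B ∷ As) rk =
  ranked-∷ {As = splice i (B ∷ As)} (ranked-head {As = B ∷ As} rk)
    (ranked-splice i (B ∷ As) (ranked-tail {A = A} {B ∷ As} rk))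

ranked-sets : (F : Flag n) → Ranked 0 (sets F)
ranked-sets []      zero = refl
ranked-sets (F ▷ i)      = ranked-splice i (sets F) (ranked-sets F)

linked-splice : (i : Fin (suc m)) {As : Vec (Subset n) (suc m)} →
  Linked _⊂_ As → Linked _⊂_ (splice i As)
linked-splice zero {A ∷ As} ch = out⊂in ⊆-refl ∷ Linked.map⁺ (Linked.map s⊂s ch)
-- The position is split twice so that `splice` on the tail reduces far enough to expose its head
-- `outside ∷ B`.
linked-splice {m = suc _} (suc zero) {A ∷ B ∷ As} (A⊂B ∷ ch) =
  s⊂s A⊂B ∷ linked-splice zero ch
linked-splice {m = suc (suc _)} (suc (suc i)) {A ∷ B ∷ C ∷ As} (A⊂B ∷ ch) =
  s⊂s A⊂B ∷ linked-splice (suc i) ch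

linked-sets : (F : Flag n) → Linked _⊂_ (sets F)
linked-sets []      = [-]
linked-sets (F ▷ i) = linked-splice i (linked-sets F)

-- A reference flag, supplying one set of each size; which flag is chosen does not matter.
flag : ∀ n → Flag n
flag zero    = []
flag (suc n) = flag n ▷ zero

-- Sums over all flags.

sumFlag : (Flag n → ℚ) → ℚ
sumFlag {zero}  f = f []
sumFlag {suc n} f = sumFlag λ F → sum λ i → f (F ▷ i)

sumFlag-cong : {f g : Flag n → ℚ} → (∀ F → f F ≡ g F) → sumFlag f ≡ sumFlag g
sumFlag-cong {zero}  f≗g = f≗g []
sumFlag-cong {suc n} f≗g = sumFlag-cong λ F → sum-cong-≗ λ i → f≗g (F ▷ i)

sumFlag-const : ∀ n (q : ℚ) → sumFlag {n} (λ _ → q) ≡ (n !) · q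
sumFlag-const zero    q = sym (×-homo-1 q)
sumFlag-const (suc n) q = begin
  sumFlag {n} (λ F → sum {suc n} (λ i → q)) ≡⟨ sumFlag-cong {n} (λ F → sum-replicate (suc n) {q}) ⟩
  sumFlag {n} (λ F → suc n · q)             ≡⟨ sumFlag-const n (suc n · q) ⟩
  (n !) · (suc n · q)                       ≡⟨ ×-assocˡ q (n !) (suc n) ⟩
  (n ! ℕ.* suc n) · q                       ≡⟨ cong (_· q) (ℕ.*-comm (n !) (suc n)) ⟩
  (suc n !) · q                             ∎
  where open ≡-Reasoning

sum-mono-≤ : {f g : Fin m → ℚ} → (∀ i → f i ≤ g i) → sum f ≤ sum g
sum-mono-≤ {zero}  f≤g = ≤-refl
sum-mono-≤ {suc m} f≤g = +-mono-≤ (f≤g zero) (sum-mono-≤ (f≤g ∘ suc))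

sumFlag-mono-≤ : {f g : Flag n → ℚ} → (∀ F → f F ≤ g F) → sumFlag f ≤ sumFlag g
sumFlag-mono-≤ {zero}  f≤g = f≤g []
sumFlag-mono-≤ {suc n} f≤g = sumFlag-mono-≤ λ F → sum-mono-≤ λ i → f≤g (F ▷ i)

sum-tight : {f g : Fin m → ℚ} →
  (∀ i → f i ≤ g i) → sum g ≤ sum f → ∀ i → g i ≤ f i
sum-tight {suc m} {f} {g} f≤g g≤f zero    = +-cancelʳ-≤ (sum (f ∘ suc))
  (≤-trans (+-monoʳ-≤ (g zero) (sum-mono-≤ (f≤g ∘ suc))) g≤f)
sum-tight {suc m} {f} {g} f≤g g≤f (suc i) = sum-tight (f≤g ∘ suc)
  (+-cancelˡ-≤ (f zero) (≤-trans (+-monoˡ-≤ (sum (g ∘ suc)) (f≤g zero)) g≤f)) i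

-- If the average attains its termwise bound, so does every term. The induction first gives this for
-- the inner sums over positions, and `sum-tight` then for each position. This carries equality in
-- the theorem to each single flag.
sumFlag-tight : {f g : Flag n → ℚ} →
  (∀ F → f F ≤ g F) → sumFlag g ≤ sumFlag f → ∀ F → g F ≤ f F
sumFlag-tight {zero}  f≤g g≤f []      = g≤f
sumFlag-tight {suc n} f≤g g≤f (F ▷ i) = sum-tight (λ i → f≤g (F ▷ i))
  (sumFlag-tight (λ F → sum-mono-≤ λ i → f≤g (F ▷ i)) g≤f F) i

-- Double counting of pairs of a flag and a set on it.

total-map : (f : Subset (suc n) → ℚ) (As : Vec (Subset n) m) →
  total f (map (inside ∷_) As) ≡ total (f ∘ (inside ∷_)) As
total-map f []       = refl
total-map f (A ∷ As) = cong (f (inside ∷ A) +_) (total-map f As)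

-- The number of positions in which a set is spliced into a flag through A to give
-- outside ∷ A, resp. inside ∷ A, is 1 + ∣ ∁ A ∣, resp. 1 + ∣ A ∣.
descend : (Subset (suc n) → ℚ) → Subset n → ℚ
descend f A = suc ∣ ∁ A ∣ · f (outside ∷ A) + suc ∣ A ∣ · f (inside ∷ A)

-- The second summand makes the identity inductive in As; it vanishes for a flag, where d = 0.
sum-splice : ∀ (f : Subset (suc n) → ℚ) d (As : Vec (Subset n) (suc m)) →
  Ranked d As → d ℕ.+ m ≡ n →
  sum (λ i → total f (splice i As)) + d · total (f ∘ (inside ∷_)) As ≡ total (descend f) As
sum-splice {n} {m} f d (A ∷ As) rk d+m≡n = begin
  (o + (i + total f (map (inside ∷_) As)) + rest) + d · (i + x)
    ≡⟨ cong₂ (λ p q → (o + (i + p) + rest) + q) (total-map f As) (×-distrib-+ i x d) ⟩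
  (o + (i + x) + rest) + (d · i + d · x)
    -- The inside copy of `A`, which only position `zero` produces, joins `d · i` to make
    -- `suc d · i`; likewise `x` joins `d · x`, as the induction on the tail requires.
    ≡⟨ regroup o i x rest (d · i) (d · x) ⟩
  (o + suc d · i) + (rest + suc d · x)
    ≡⟨ tail-step As rk d+m≡n ⟩
  (suc m · o + suc d · i) + total (descend f) As
    ≡⟨ cong₂ (λ a b → (suc a · o + suc b · i) + total (descend f) As) (sym codim) (sym ∣A∣≡d) ⟩
  descend f A + total (descend f) As ∎
  where
  open ≡-Reasoning
  o = f (outside ∷ A)
  i = f (inside ∷ A)
  x = total (f ∘ (inside ∷_)) As
  rest = sum (λ j → total f (splice (suc j) (A ∷ As)))
  ∣A∣≡d : ∣ A ∣ ≡ d
  ∣A∣≡d = ranked-head {As = As} rk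
  codim : ∣ ∁ A ∣ ≡ m
  codim = begin
    ∣ ∁ A ∣          ≡⟨ ∣∁p∣≡n∸∣p∣ A ⟩
    n ℕ.∸ ∣ A ∣      ≡⟨ cong₂ ℕ._∸_ (sym d+m≡n) ∣A∣≡d ⟩
    d ℕ.+ m ℕ.∸ d    ≡⟨ ℕ.m+n∸m≡n d m ⟩
    m                ∎
  regroup : ∀ o i x r di dx → (o + (i + x) + r) + (di + dx) ≡ (o + (i + di)) + (r + (x + dx))
  regroup = solve 6 (λ o i x r di dx →
    ((o ⊕ (i ⊕ x)) ⊕ r) ⊕ (di ⊕ dx) ⊜ (o ⊕ (i ⊕ di)) ⊕ (r ⊕ (x ⊕ dx))) refl
  regroup′ : ∀ o i mo t dx → (o + i) + ((mo + t) + dx) ≡ ((o + mo) + i) + (t + dx)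
  regroup′ = solve 5 (λ o i mo t dx → (o ⊕ i) ⊕ ((mo ⊕ t) ⊕ dx) ⊜ ((o ⊕ mo) ⊕ i) ⊕ (t ⊕ dx)) refl
  -- Each of the `m` positions after `A` contributes `o` once, which accounts for `m · o`. What is
  -- left is the claim for the tail with offset `suc d`. The length is quantified afresh so that
  -- `As` can be split.
  tail-step : ∀ {m} (As : Vec (Subset n) m) → Ranked d (A ∷ As) → d ℕ.+ m ≡ n →
    (o + suc d · i) +
      (sum (λ j → total f (splice (suc j) (A ∷ As))) + suc d · total (f ∘ (inside ∷_)) As)
    ≡ (suc m · o + suc d · i) + total (descend f) As
  tail-step [] _ _ = cong₂ _+_ (cong (_+ suc d · i) (sym (×-homo-1 o)))
    (trans (+-identityˡ _) (·-zero (suc d)))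
  tail-step {suc m} (B ∷ As) rk d+m≡n = begin
    (o + suc d · i) + (sum (λ j → o + total f (splice j (B ∷ As))) + dx)
      ≡⟨ cong (λ p → (o + suc d · i) + (p + dx))
           (trans (∑-distrib-+ (λ _ → o) (λ j → total f (splice j (B ∷ As))))
                  (cong (_+ sum (λ j → total f (splice j (B ∷ As)))) (sum-replicate (suc m) {o}))) ⟩
    (o + suc d · i) + ((suc m · o + sum (λ j → total f (splice j (B ∷ As)))) + dx)
      ≡⟨ regroup′ o (suc d · i) (suc m · o) _ dx ⟩
    (suc (suc m) · o + suc d · i) + (sum (λ j → total f (splice j (B ∷ As))) + dx)
      ≡⟨ cong (suc (suc m) · o + suc d · i +_)
           (sum-splice f (suc d) (B ∷ As) (ranked-tail {A = A} {B ∷ As} rk)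
             (trans (sym (ℕ.+-suc d m)) d+m≡n)) ⟩
    (suc (suc m) · o + suc d · i) + total (descend f) (B ∷ As) ∎
    where dx = suc d · total (f ∘ (inside ∷_)) (B ∷ As)

flagsThrough : Subset n → ℕ
flagsThrough A = ∣ A ∣ ! ℕ.* ∣ ∁ A ∣ !

-- The factor `suc ∣ ∁ A ∣` or `suc ∣ A ∣` of `descend` is absorbed into the matching factorial,
-- turning the flags through `A` into those through `outside ∷ A` or `inside ∷ A`.
flagsThrough-descend : (f : Subset (suc n) → ℚ) (A : Subset n) →
  flagsThrough A · descend f A ≡
  flagsThrough (outside ∷ A) · f (outside ∷ A) + flagsThrough (inside ∷ A) · f (inside ∷ A)
flagsThrough-descend f A = begin
  t · (suc b · o + suc a · i)
    ≡⟨ ×-distrib-+ (suc b · o) (suc a · i) t ⟩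
  t · (suc b · o) + t · (suc a · i)
    ≡⟨ cong₂ _+_ (×-assocˡ o t (suc b)) (×-assocˡ i t (suc a)) ⟩
  (t ℕ.* suc b) · o + (t ℕ.* suc a) · i
    ≡⟨ cong₂ (λ p q → p · o + q · i) outside-eq inside-eq ⟩
  flagsThrough (outside ∷ A) · o + flagsThrough (inside ∷ A) · i ∎
  where
  open ≡-Reasoning
  a = ∣ A ∣
  b = ∣ ∁ A ∣
  t = flagsThrough A
  o = f (outside ∷ A)
  i = f (inside ∷ A)
  outside-eq : a ! ℕ.* b ! ℕ.* suc b ≡ a ! ℕ.* (suc b) !
  outside-eq = trans (ℕ.*-assoc (a !) (b !) (suc b)) (cong (a ! ℕ.*_) (ℕ.*-comm (b !) (suc b)))
  inside-eq : a ! ℕ.* b ! ℕ.* suc a ≡ (suc a) ! ℕ.* b !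
  inside-eq = trans (ℕ.*-comm (a ! ℕ.* b !) (suc a)) (sym (ℕ.*-assoc (suc a) (a !) (b !)))

-- Induction on the dimension: summing over the insertion positions replaces `f` by `descend f` on
-- the smaller cube, and the factors of `descend` are those by which `flagsThrough` grows.
sumFlag-total : (f : Subset n → ℚ) →
  sumFlag (λ F → total f (sets F)) ≡ ∑Subset (λ A → flagsThrough A · f A)
sumFlag-total {zero}  f = refl
sumFlag-total {suc n} f = begin
  sumFlag (λ F → sum λ i → total f (splice i (sets F)))
    ≡⟨ sumFlag-cong (λ F → trans (sym (+-identityʳ _))
         (sum-splice f 0 (sets F) (ranked-sets F) refl)) ⟩
  sumFlag (λ F → total (descend f) (sets F))
    ≡⟨ sumFlag-total (descend f) ⟩
  ∑Subset (λ A → flagsThrough A · descend f A)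
    ≡⟨ ∑Subset-cong (flagsThrough-descend f) ⟩
  ∑Subset (λ A →
    flagsThrough (outside ∷ A) · f (outside ∷ A) + flagsThrough (inside ∷ A) · f (inside ∷ A))
    ≡⟨ ∑Subset-+ (λ A → flagsThrough (outside ∷ A) · f (outside ∷ A)) _ ⟩
  ∑Subset (λ A → flagsThrough A · f A) ∎
  where open ≡-Reasoning

-- Functions with the same total on every flag.

-- The two splices differ in one set: only the first contains `inside ∷ Aᵢ`, only the second
-- `outside ∷ Aᵢ₊₁`. Adding the missing set to each side avoids subtraction.
total-swap : ∀ (f : Subset (suc n) → ℚ) (i : Fin m) (As : Vec (Subset n) (suc m)) →
  total f (splice (inject₁ i) As) + f (outside ∷ lookup As (suc i)) ≡
  total f (splice (suc i) As) + f (inside ∷ lookup As (inject₁ i))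
total-swap f zero (A ∷ B ∷ As) =
  swap (f (outside ∷ A)) (f (inside ∷ A)) (f (inside ∷ B) + total f (map (inside ∷_) As))
       (f (outside ∷ B))
  where
  swap : ∀ a b c d → (a + (b + c)) + d ≡ (a + (d + c)) + b
  swap = solve 4 (λ a b c d → (a ⊕ (b ⊕ c)) ⊕ d ⊜ (a ⊕ (d ⊕ c)) ⊕ b) refl
total-swap f (suc i) (A ∷ B ∷ As) = begin
  (f (outside ∷ A) + total f (splice (inject₁ i) (B ∷ As))) + o
    ≡⟨ +-assoc (f (outside ∷ A)) _ o ⟩
  f (outside ∷ A) + (total f (splice (inject₁ i) (B ∷ As)) + o)
    ≡⟨ cong (f (outside ∷ A) +_) (total-swap f i (B ∷ As)) ⟩
  f (outside ∷ A) + (total f (splice (suc i) (B ∷ As)) + i′)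
    ≡⟨ +-assoc (f (outside ∷ A)) _ i′ ⟨
  (f (outside ∷ A) + total f (splice (suc i) (B ∷ As))) + i′ ∎
  where
  open ≡-Reasoning
  o = f (outside ∷ lookup (B ∷ As) (suc i))
  i′ = f (inside ∷ lookup (B ∷ As) (inject₁ i))

total-splice-last : ∀ (f : Subset (suc n) → ℚ) (As : Vec (Subset n) (suc m)) →
  total f (splice (fromℕ m) As) ≡ total (f ∘ (outside ∷_)) As + f (inside ∷ lookup As (fromℕ m))
total-splice-last f (A ∷ []) = begin
  o + (i + 0ℚ) ≡⟨ cong (o +_) (+-identityʳ i) ⟩
  o + i        ≡⟨ cong (_+ i) (+-identityʳ o) ⟨
  o + 0ℚ + i   ∎
  where
  open ≡-Reasoning
  o = f (outside ∷ A)
  i = f (inside ∷ A)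
total-splice-last f (A ∷ As@(_ ∷ _)) =
  trans (cong (f (outside ∷ A) +_) (total-splice-last f As)) (sym (+-assoc (f (outside ∷ A)) _ _))

total-splice-zero : ∀ (f : Subset (suc n) → ℚ) (As : Vec (Subset n) (suc m)) →
  total f (splice zero As) ≡ f (outside ∷ lookup As zero) + total (f ∘ (inside ∷_)) As
total-splice-zero f (A ∷ As) = cong (λ q → f (outside ∷ A) + (f (inside ∷ A) + q)) (total-map f As)

∣p∣≡0⇒p≡⊥ : (p : Subset n) → ∣ p ∣ ≡ 0 → p ≡ ⊥
∣p∣≡0⇒p≡⊥ []            _     = refl
∣p∣≡0⇒p≡⊥ (outside ∷ p) ∣p∣≡0 = cong (outside ∷_) (∣p∣≡0⇒p≡⊥ p ∣p∣≡0)

sets-first : (F : Flag n) → lookup (sets F) zero ≡ ⊥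
sets-first F = ∣p∣≡0⇒p≡⊥ _ (ranked-sets F zero)

sets-last : (F : Flag n) → lookup (sets F) (fromℕ n) ≡ ⊤
sets-last {n} F = ∣p∣≡n⇒p≡⊤ (trans (ranked-sets F (fromℕ n)) (toℕ-fromℕ n))

LevelConstant : (Subset n → ℚ) → Set
LevelConstant f = ∀ A B → ∣ A ∣ ≡ ∣ B ∣ → f A ≡ f B

-- Flags spliced at consecutive positions differ in a single set, so f agrees on the two
-- sets that are exchanged; this glues the levels of the two halves of the cube.
constantTotal⇒levelConstant : (f : Subset n → ℚ) →
  (∀ F G → total f (sets F) ≡ total f (sets G)) → LevelConstant f
constantTotal⇒levelConstant {zero}  f const [] [] _ = refl
constantTotal⇒levelConstant {suc n} f const = levelConstant
  where
  open ≡-Reasoning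
  f₀ f₁ : Subset n → ℚ
  f₀ = f ∘ (outside ∷_)
  f₁ = f ∘ (inside ∷_)

  -- Splicing at the last position keeps the whole flag in the outside half and adds only
  -- `inside ∷ ⊤`, a term common to all flags. Position `zero` serves the inside half in the same
  -- way, with `outside ∷ ⊥`.
  const₀ : ∀ F G → total f₀ (sets F) ≡ total f₀ (sets G)
  const₀ F G = +-cancelʳ (f₁ ⊤) _ _ (begin
    total f₀ (sets F) + f₁ ⊤        ≡⟨ split F ⟨
    total f (sets (F ▷ fromℕ n))    ≡⟨ const (F ▷ fromℕ n) (G ▷ fromℕ n) ⟩
    total f (sets (G ▷ fromℕ n))    ≡⟨ split G ⟩
    total f₀ (sets G) + f₁ ⊤        ∎)
    where
    split : ∀ F → total f (sets (F ▷ fromℕ n)) ≡ total f₀ (sets F) + f₁ ⊤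
    split F = trans (total-splice-last f (sets F))
      (cong (λ A → total f₀ (sets F) + f₁ A) (sets-last F))

  const₁ : ∀ F G → total f₁ (sets F) ≡ total f₁ (sets G)
  const₁ F G = +-cancelˡ (f₀ ⊥) _ _ (begin
    f₀ ⊥ + total f₁ (sets F)   ≡⟨ split F ⟨
    total f (sets (F ▷ zero))  ≡⟨ const (F ▷ zero) (G ▷ zero) ⟩
    total f (sets (G ▷ zero))  ≡⟨ split G ⟩
    f₀ ⊥ + total f₁ (sets G)   ∎)
    where
    split : ∀ F → total f (sets (F ▷ zero)) ≡ f₀ ⊥ + total f₁ (sets F)
    split F = trans (total-splice-zero f (sets F))
      (cong (λ A → f₀ A + total f₁ (sets F)) (sets-first F))

  levelConstant₀ : LevelConstant f₀
  levelConstant₀ = constantTotal⇒levelConstant f₀ const₀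

  levelConstant₁ : LevelConstant f₁
  levelConstant₁ = constantTotal⇒levelConstant f₁ const₁

  F = flag n

  exchange : ∀ i → f₁ (lookup (sets F) (inject₁ i)) ≡ f₀ (lookup (sets F) (suc i))
  exchange i = +-cancelˡ (total f (sets (F ▷ suc i))) _ _ (trans
    (sym (total-swap f i (sets F)))
    (cong (_+ f₀ (lookup (sets F) (suc i))) (const (F ▷ inject₁ i) (F ▷ suc i))))

  -- Constancy within each half moves `A` and `B` to the two sets exchanged on the reference flag.
  glue : ∀ A B → suc ∣ A ∣ ≡ ∣ B ∣ → f₁ A ≡ f₀ B
  glue A B ∣A∣<∣B∣ = begin
    f₁ A
      ≡⟨ levelConstant₁ A _ (sym (trans (ranked-sets F (inject₁ i))
           (trans (toℕ-inject₁ i) toℕ-i))) ⟩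
    f₁ (lookup (sets F) (inject₁ i))
      ≡⟨ exchange i ⟩
    f₀ (lookup (sets F) (suc i))
      ≡⟨ levelConstant₀ _ B (trans (ranked-sets F (suc i)) (trans (cong suc toℕ-i) ∣A∣<∣B∣)) ⟩
    f₀ B ∎
    where
    i : Fin n
    -- The index is `∣ A ∣`, which is below `n` because `B` has one element more and at most `n`.
    i = fromℕ< (subst (ℕ._≤ n) (sym ∣A∣<∣B∣) (∣p∣≤n B))
    toℕ-i : toℕ i ≡ ∣ A ∣
    toℕ-i = toℕ-fromℕ< _

  levelConstant : LevelConstant f
  levelConstant (outside ∷ A) (outside ∷ B) eq = levelConstant₀ A B eq
  levelConstant (outside ∷ A) (inside  ∷ B) eq = sym (glue B A (sym eq))
  levelConstant (inside  ∷ A) (outside ∷ B) eq = glue A B eq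
  levelConstant (inside  ∷ A) (inside  ∷ B) eq = levelConstant₁ A B (ℕ.suc-injective eq)

-- Flags through a set and binomial coefficients.

binomial-flagsThrough : (A : Subset n) → flagsThrough A ℕ.* (n C ∣ A ∣) ≡ n !
binomial-flagsThrough {n} A = begin
  flagsThrough A ℕ.* (n C a)
    ≡⟨ cong₂ (λ b q → a ! ℕ.* b ! ℕ.* q) (∣∁p∣≡n∸∣p∣ A) (nCk≡n!/k![n-k]! a≤n) ⟩
  a ! ℕ.* (n ℕ.∸ a) ! ℕ.* ((n !) ℕ./ (a ! ℕ.* (n ℕ.∸ a) !))
    ≡⟨ m*[n/m]≡n (k![n∸k]!∣n! a≤n) ⟩
  n ! ∎
  where
  open ≡-Reasoning
  a = ∣ A ∣
  a≤n = ∣p∣≤n A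
  instance _ = a ℕ.!* (n ℕ.∸ a) !≢0

-- Chains in the family against counts along a flag.

linked-∷ : ∀ {A : Subset n} {As : Vec (Subset n) m} →
  All (A ⊂_) As → Linked _⊂_ As → Linked _⊂_ (A ∷ As)
linked-∷ []         []           = [-]
linked-∷ (A⊂B ∷ _)  ch@[-]       = A⊂B ∷ ch
linked-∷ (A⊂B ∷ _)  ch@(_ ∷ _)   = A⊂B ∷ ch

linked⇒all : ∀ {A : Subset n} {As : Vec (Subset n) m} → Linked _⊂_ (A ∷ As) → All (A ⊂_) As
linked⇒all [-]        = []
linked⇒all (A⊂B ∷ ch) = Linked.Linked⇒All ⊂-trans A⊂B ch

LevelClosed : ∀ {ℓ} → Pred (Subset n) ℓ → Set ℓ
LevelClosed 𝒜 = ∀ {A B} → ∣ A ∣ ≡ ∣ B ∣ → 𝒜 A → 𝒜 B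

module _ {ℓ} {𝒜 : Pred (Subset n) ℓ} (𝒜? : Decidable 𝒜) where

  -- The last component strengthens the induction: when the successor of a kept set is dropped, that
  -- set must be linked to a later one, hence must lie below all that survive.
  filterChain : (As : Vec (Subset n) m) → Linked _⊂_ As →
    Σ[ Bs ∈ Vec (Subset n) (count 𝒜? As) ] Linked _⊂_ Bs × All 𝒜 Bs ×
      (∀ {A} → A ∈ As → 𝒜 A → A ∈ Bs) × (∀ {C} → All (C ⊂_) As → All (C ⊂_) Bs)
  filterChain []       _  = [] , [] , [] , (λ ()) , λ _ → []
  filterChain (A ∷ As) ch with 𝒜? A | filterChain As (Linked.tail ch)
  ... | yes A∈𝒜 | Bs , ch′ , Bs⊆𝒜 , keep , below =
    A ∷ Bs , linked-∷ (below (linked⇒all ch)) ch′ , A∈𝒜 ∷ Bs⊆𝒜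
    , (λ { (here refl) _ → here refl ; (there B∈As) B∈𝒜 → there (keep B∈As B∈𝒜) })
    , λ { (C⊂A ∷ C⊂As) → C⊂A ∷ below C⊂As }
  ... | no  A∉𝒜 | Bs , ch′ , Bs⊆𝒜 , keep , below =
    Bs , ch′ , Bs⊆𝒜
    , (λ { (here refl) A∈𝒜 → contradiction A∈𝒜 A∉𝒜 ; (there B∈As) B∈𝒜 → keep B∈As B∈𝒜 })
    , λ { (_ ∷ C⊂As) → below C⊂As }

  count≤c : ∀ {As : Vec (Subset n) m} {A} → Linked _⊂_ As → A ∈ As → 𝒜 A → count 𝒜? As ℕ.≤ c 𝒜? A
  count≤c {As = As} ch A∈As A∈𝒜 with filterChain As ch
  ... | Bs , ch′ , Bs⊆𝒜 , keep , _ =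
    proj₂ (c-isMaximum 𝒜? A∈𝒜) (Bs , ch′ , Bs⊆𝒜 , keep A∈As A∈𝒜)

  count-tail-≤ : ∀ A (As : Vec (Subset n) m) → count 𝒜? As ℕ.≤ count 𝒜? (A ∷ As)
  count-tail-≤ A As with 𝒜? A
  ... | yes _ = ℕ.n≤1+n _
  ... | no  _ = ℕ.≤-refl

  count-tail-< : ∀ {A} (As : Vec (Subset n) m) → 𝒜 A → count 𝒜? As ℕ.< count 𝒜? (A ∷ As)
  count-tail-< {A = A} As A∈𝒜 with 𝒜? A
  ... | yes _   = ℕ.≤-refl
  ... | no  A∉𝒜 = contradiction A∈𝒜 A∉𝒜

  -- `As` has one set of each size from `d` to `n`, and `Bs` at most one of each size. Sweeping
  -- upwards, a `B` of size `d` is charged to `A`, which closure puts in `𝒜`; a size that `Bs`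
  -- misses is passed over.
  chain≤count : LevelClosed 𝒜 → ∀ {d} (As : Vec (Subset n) m) → Ranked d As → d ℕ.+ m ≡ suc n →
    (Bs : Vec (Subset n) k) → Linked _⊂_ Bs → All 𝒜 Bs → All (λ B → d ℕ.≤ ∣ B ∣) Bs →
    k ℕ.≤ count 𝒜? As
  chain≤count closed As rk eq [] _ _ _ = ℕ.z≤n
  -- Here `d = n + 1`, too large for the size of `B`.
  chain≤count closed {d} [] rk eq (B ∷ Bs) _ _ (d≤∣B∣ ∷ _) = contradiction
    (ℕ.≤-trans (ℕ.≤-reflexive (trans (sym eq) (ℕ.+-identityʳ d))) (ℕ.≤-trans d≤∣B∣ (∣p∣≤n B)))
    ℕ.1+n≰n
  chain≤count {m = suc m} closed {d} (A ∷ As) rk eq (B ∷ Bs) ch (B∈𝒜 ∷ Bs⊆𝒜) (d≤∣B∣ ∷ _)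
    with ℕ.m≤n⇒m<n∨m≡n d≤∣B∣
  ... | inj₁ d<∣B∣ = ℕ.≤-trans
    (chain≤count closed As (ranked-tail {A = A} {As} rk) (trans (sym (ℕ.+-suc d m)) eq)
      (B ∷ Bs) ch (B∈𝒜 ∷ Bs⊆𝒜)
      (d<∣B∣ ∷ All.map (ℕ.<-trans d<∣B∣ ∘ p⊂q⇒∣p∣<∣q∣) (linked⇒all ch)))
    (count-tail-≤ A As)
  ... | inj₂ refl  = ℕ.<-≤-trans
    (ℕ.s≤s (chain≤count closed As (ranked-tail {A = A} {As} rk) (trans (sym (ℕ.+-suc d m)) eq)
      Bs (Linked.tail ch) Bs⊆𝒜 (All.map p⊂q⇒∣p∣<∣q∣ (linked⇒all ch))))
    (count-tail-< As (closed (sym (ranked-head {As = As} rk)) B∈𝒜))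

  c≤count : LevelClosed 𝒜 → ∀ F {A} → 𝒜 A → c 𝒜? A ℕ.≤ count 𝒜? (sets F)
  c≤count closed F A∈𝒜 with proj₁ (c-isMaximum 𝒜? A∈𝒜)
  ... | Bs , ch , Bs⊆𝒜 , _ =
    chain≤count closed (sets F) (ranked-sets F) refl Bs ch Bs⊆𝒜 (All.universal (λ _ → ℕ.z≤n) Bs)

  -- Recovering the index set from the reference flag.

  levels : Subset (suc n)
  levels = tabulate (does ∘ 𝒜? ∘ lookup (sets (flag n)))

  lookup-levels : ∀ i → lookup levels i ≡ does (𝒜? (lookup (sets (flag n)) i))
  lookup-levels = Vec.lookup∘tabulate (does ∘ 𝒜? ∘ lookup (sets (flag n)))

  ∈levels⁺ : ∀ i → 𝒜 (lookup (sets (flag n)) i) → i ∈ˢ levels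
  ∈levels⁺ i Aᵢ∈𝒜 = Vec.lookup⇒[]= i levels
    (trans (lookup-levels i) (dec-true (𝒜? _) Aᵢ∈𝒜))

  ∈levels⁻ : ∀ i → i ∈ˢ levels → 𝒜 (lookup (sets (flag n)) i)
  ∈levels⁻ i i∈levels = does⁻ (𝒜? _) (trans (sym (lookup-levels i)) (Vec.[]=⇒lookup i∈levels))
    where
    does⁻ : ∀ {p} {P : Set p} (P? : Dec P) → does P? ≡ true → P
    does⁻ (yes p) _ = p

  ≐unionOfLevels : LevelClosed 𝒜 → 𝒜 ≐ unionOfLevels levels
  ≐unionOfLevels closed = to , from
    where
    F = flag n
    to : ∀ {A} → 𝒜 A → unionOfLevels levels A
    to {A} A∈𝒜 = i , ∈levels⁺ i (closed (trans (sym toℕ-i) (sym (ranked-sets F i))) A∈𝒜) , sym toℕ-i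
      where
      i = fromℕ< (ℕ.s≤s (∣p∣≤n A))
      toℕ-i = toℕ-fromℕ< (ℕ.s≤s (∣p∣≤n A))
    from : ∀ {A} → unionOfLevels levels A → 𝒜 A
    from (i , i∈levels , ∣A∣≡i) = closed (trans (ranked-sets F i) (sym ∣A∣≡i)) (∈levels⁻ i i∈levels)

-- Averaging over flags, and the case of equality.

-- h plays the role of c.
module Height {ℓ} {𝒜 : Pred (Subset n) ℓ} (𝒜? : Decidable 𝒜)
  (h : Subset n → ℕ) (h≢0 : ∀ {A} → 𝒜 A → NonZero (h A))
  (count≤h : ∀ F {A} → A ∈ sets F → 𝒜 A → count 𝒜? (sets F) ℕ.≤ h A) where

  -- For `h = c 𝒜?` this is `weight 𝒜?` by definition, so the results below apply to it directly.
  hWeight : (A : Subset n) → 𝒜 A → ℚ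
  hWeight A A∈𝒜 = (1ℤ / ((n C ∣ A ∣) ℕ.* h A)) {{ℕ.m*n≢0 _ _ {{nC∣A∣≢0 A}} {{h≢0 A∈𝒜}}}}

  share : Subset n → ℚ
  share A = restrict (𝒜? A) λ A∈𝒜 → (1ℤ / h A) {{h≢0 A∈𝒜}}

  total-share-≤ : ∀ b .{{b≢0 : NonZero b}} (As : Vec (Subset n) m) →
    (∀ {A} → A ∈ As → 𝒜 A → b ℕ.≤ h A) → total share As ≤ count 𝒜? As · (1ℤ / b)
  total-share-≤ b {{b≢0}} As b≤h =
    total-restrict-≤ 𝒜? (λ A A∈𝒜 → (1ℤ / h A) {{h≢0 A∈𝒜}}) As λ {A} A∈As A∈𝒜 →
      1/-antimono-≤ b (h A) {{b≢0}} {{h≢0 A∈𝒜}} (b≤h A∈As A∈𝒜)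

  total-share-≡ : ∀ b .{{_ : NonZero b}} (As : Vec (Subset n) m) →
    (∀ {A} → A ∈ As → 𝒜 A → b ≡ h A) → total share As ≡ count 𝒜? As · (1ℤ / b)
  total-share-≡ b As b≡h =
    total-restrict-≡ 𝒜? (λ A A∈𝒜 → (1ℤ / h A) {{h≢0 A∈𝒜}}) As λ A∈As A∈𝒜 →
      /-cong {p₁ = 1ℤ} {{h≢0 A∈𝒜}} refl (sym (b≡h A∈As A∈𝒜))

  -- If `b` members of `𝒜` lie on `F`, each has height at least `b`, so the total is at most `b`
  -- times `1 / b`.
  flag-share-≤1 : ∀ F → total share (sets F) ≤ 1ℚ
  flag-share-≤1 F = by-count (count 𝒜? (sets F)) refl
    where
    open ≤-Reasoning
    by-count : ∀ b → count 𝒜? (sets F) ≡ b → total share (sets F) ≤ 1ℚ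
    -- There is no `1 / 0`; the bound 1 on heights serves instead, since it is multiplied by a count
    -- of 0.
    by-count zero    eq = begin
      total share (sets F)              ≤⟨ total-share-≤ 1 (sets F) (λ _ A∈𝒜 →
                                             ℕ.>-nonZero⁻¹ _ {{h≢0 A∈𝒜}}) ⟩
      count 𝒜? (sets F) · (1ℤ / 1)      ≡⟨ cong (_· (1ℤ / 1)) eq ⟩
      0ℚ                                ≤⟨ toWitness {a? = 0ℚ ≤? 1ℚ} _ ⟩
      1ℚ                                ∎
    by-count (suc b) eq = begin
      total share (sets F)              ≤⟨ total-share-≤ (suc b) (sets F) (λ {A} A∈F A∈𝒜 →
                                             subst (ℕ._≤ h A) eq (count≤h F A∈F A∈𝒜)) ⟩
      count 𝒜? (sets F) · (1ℤ / suc b)  ≡⟨ cong (_· (1ℤ / suc b)) eq ⟩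
      suc b · (1ℤ / suc b)              ≡⟨ ·-1/-self (suc b) ⟩
      1ℚ                                ∎

  flag-share-≡1 : (∀ F {A} → 𝒜 A → h A ℕ.≤ count 𝒜? (sets F)) → ∃ 𝒜 →
    ∀ F → total share (sets F) ≡ 1ℚ
  flag-share-≡1 h≤count (A , A∈𝒜) F = trans
    (total-share-≡ (count 𝒜? (sets F)) (sets F) λ B∈F B∈𝒜 →
      ℕ.≤-antisym (count≤h F B∈F B∈𝒜) (h≤count F B∈𝒜))
    (·-1/-self (count 𝒜? (sets F)))
    -- This is where a member of `𝒜` is needed: its height is positive and at most the count, so
    -- every flag meets `𝒜`.
    where instance _ = ℕ.>-nonZero (ℕ.≤-trans (ℕ.>-nonZero⁻¹ _ {{h≢0 A∈𝒜}}) (h≤count F A∈𝒜))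

  -- Since `n !` is `flagsThrough A` times the binomial coefficient, the latter cancels and
  -- `1 / h A` remains.
  !·restrict-hWeight : ∀ A → (n !) · restrict (𝒜? A) (hWeight A) ≡ flagsThrough A · share A
  !·restrict-hWeight A = restrict-·-cong (𝒜? A) (n !) (flagsThrough A) λ A∈𝒜 →
    !·-cong (hWeight A A∈𝒜) (·-1/-cancel (n C ∣ A ∣) (h A) {{h≢0 A∈𝒜}}
      {{ℕ.m*n≢0 _ _ {{nC∣A∣≢0 A}} {{h≢0 A∈𝒜}}}})
    where
    open ≡-Reasoning
    !·-cong : ∀ w {q} → (n C ∣ A ∣) · w ≡ q → (n !) · w ≡ flagsThrough A · q
    !·-cong w {q} eq = begin
      (n !) · w                              ≡⟨ cong (_· w) (binomial-flagsThrough A) ⟨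
      (flagsThrough A ℕ.* (n C ∣ A ∣)) · w   ≡⟨ ×-assocˡ w (flagsThrough A) (n C ∣ A ∣) ⟨
      flagsThrough A · ((n C ∣ A ∣) · w)     ≡⟨ cong (flagsThrough A ·_) eq ⟩
      flagsThrough A · q                     ∎

  !·∑hWeight : (n !) · ∑ 𝒜? hWeight ≡ sumFlag (λ F → total share (sets F))
  !·∑hWeight = begin
    (n !) · ∑ 𝒜? hWeight
      ≡⟨ cong ((n !) ·_) (∑≡∑Subset 𝒜? hWeight) ⟩
    (n !) · ∑Subset (λ A → restrict (𝒜? A) (hWeight A))
      ≡⟨ ∑Subset-· (n !) (λ A → restrict (𝒜? A) (hWeight A)) ⟩
    ∑Subset (λ A → (n !) · restrict (𝒜? A) (hWeight A))
      ≡⟨ ∑Subset-cong !·restrict-hWeight ⟩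
    ∑Subset (λ A → flagsThrough A · share A)
      ≡⟨ sumFlag-total share ⟨
    sumFlag (λ F → total share (sets F)) ∎
    where open ≡-Reasoning

  ∑hWeight≤1 : ∑ 𝒜? hWeight ≤ 1ℚ
  ∑hWeight≤1 = ·-cancel-≤ (n !) {{n ℕ.!≢0}} (begin
    (n !) · ∑ 𝒜? hWeight                  ≡⟨ !·∑hWeight ⟩
    sumFlag (λ F → total share (sets F))  ≤⟨ sumFlag-mono-≤ flag-share-≤1 ⟩
    sumFlag {n} (λ _ → 1ℚ)                ≡⟨ sumFlag-const n 1ℚ ⟩
    (n !) · 1ℚ                            ∎)
    where open ≤-Reasoning

  h≤count⇒∑hWeight≡1 : (∀ F {A} → 𝒜 A → h A ℕ.≤ count 𝒜? (sets F)) → ∃ 𝒜 → ∑ 𝒜? hWeight ≡ 1ℚ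
  h≤count⇒∑hWeight≡1 h≤count ∃𝒜 = ≤-antisym ∑hWeight≤1 (·-cancel-≤ (n !) {{n ℕ.!≢0}} (begin
    (n !) · 1ℚ                            ≡⟨ sumFlag-const n 1ℚ ⟨
    sumFlag {n} (λ _ → 1ℚ)                ≡⟨ sumFlag-cong (flag-share-≡1 h≤count ∃𝒜) ⟨
    sumFlag (λ F → total share (sets F))  ≡⟨ !·∑hWeight ⟨
    (n !) · ∑ 𝒜? hWeight                  ∎))
    where open ≤-Reasoning

  ∑hWeight≡1⇒flag-share≡1 : ∑ 𝒜? hWeight ≡ 1ℚ → ∀ F → total share (sets F) ≡ 1ℚ
  ∑hWeight≡1⇒flag-share≡1 ∑≡1 F =
    ≤-antisym (flag-share-≤1 F) (sumFlag-tight flag-share-≤1 (≤-reflexive (begin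
      sumFlag {n} (λ _ → 1ℚ)                ≡⟨ sumFlag-const n 1ℚ ⟩
      (n !) · 1ℚ                            ≡⟨ cong ((n !) ·_) ∑≡1 ⟨
      (n !) · ∑ 𝒜? hWeight                  ≡⟨ !·∑hWeight ⟩
      sumFlag (λ F → total share (sets F))  ∎)) F)
    where open ≡-Reasoning

  -- `share` is positive exactly on `𝒜`, so its constancy on levels passes to its support.
  levelConstant⇒levelClosed : LevelConstant share → LevelClosed 𝒜
  levelConstant⇒levelClosed const {A} {B} ∣A∣≡∣B∣ A∈𝒜 = restrict-positive⁻¹ (𝒜? B) (begin-strict
    0ℚ      <⟨ restrict-positive (𝒜? A) A∈𝒜 (λ p → 1/-positive (h A) {{h≢0 p}}) ⟩
    share A ≡⟨ const A B ∣A∣≡∣B∣ ⟩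
    share B ∎)
    where open ≤-Reasoning

-- Unions of levels, and the specialisation to `c`.

≐unionOfLevels⇒levelClosed : ∀ {ℓ} {𝒜 : Pred (Subset n) ℓ} I → 𝒜 ≐ unionOfLevels I → LevelClosed 𝒜
≐unionOfLevels⇒levelClosed I (to , from) ∣A∣≡∣B∣ A∈𝒜 with to A∈𝒜
... | i , i∈I , ∣A∣≡i = from (i , i∈I , trans (sym ∣A∣≡∣B∣) ∣A∣≡i)

theorem4 : ∀ {ℓ} (n : ℕ) (𝒜 : Pred (Subset n) ℓ) (𝒜? : Decidable 𝒜) →
    (∑ 𝒜? (weight 𝒜?) ≤ 1ℚ) ×
    (∑ 𝒜? (weight 𝒜?) ≡ 1ℚ ⇔ (Σ[ I ∈ Subset (suc n) ] Nonempty I × 𝒜 ≐ unionOfLevels I))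
theorem4 n 𝒜 𝒜? = ∑hWeight≤1 , mk⇔ to from
  where
  open Height 𝒜? (c 𝒜?) (c≢0 𝒜?) (λ F → count≤c 𝒜? (linked-sets F))
  to : ∑ 𝒜? (weight 𝒜?) ≡ 1ℚ → Σ[ I ∈ Subset (suc n) ] Nonempty I × 𝒜 ≐ unionOfLevels I
  to ∑≡1 = levels 𝒜? , nonempty , ≐unionOfLevels 𝒜? (levelConstant⇒levelClosed
    (constantTotal⇒levelConstant share λ F G → trans (share≡1 F) (sym (share≡1 G))))
    where
    share≡1 : ∀ F → total share (sets F) ≡ 1ℚ
    share≡1 = ∑hWeight≡1⇒flag-share≡1 ∑≡1
    nonempty : Nonempty (levels 𝒜?)
    nonempty = let i , Aᵢ∈𝒜 = total-restrict-≡1⇒∃ 𝒜? _ (sets (flag n)) (share≡1 (flag n))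
               in i , ∈levels⁺ 𝒜? i Aᵢ∈𝒜
  from : Σ[ I ∈ Subset (suc n) ] Nonempty I × 𝒜 ≐ unionOfLevels I → ∑ 𝒜? (weight 𝒜?) ≡ 1ℚ
  from (I , (i , i∈I) , 𝒜≐) = h≤count⇒∑hWeight≡1
    (c≤count 𝒜? (≐unionOfLevels⇒levelClosed I 𝒜≐))
    -- The witness that `𝒜` is nonempty is the set of size `i` on the reference flag.
    (lookup (sets (flag n)) i , proj₂ 𝒜≐ (i , i∈I , ranked-sets (flag n) i))
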